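{- $$\sum_{\pi\in\mathcal{G}_O^{N}}q^{|\pi|}=\frac{1}{(q;q)_\infty}\sum_{n\geq 1}q^n(q^2;q^2)_{n-1}=(-q;q)_\infty\sum_{n\geq0} \frac{q^{2n+1}}{1-q^{2n+1}}\frac{1}{(q^2;q^2)_n} .$$
   Context: An overpartition is a finite non-increasing sequence of positive integers (its parts) in which the first occurrence of each number may be overlined (so for each size $t$ at most one part of size $t$ is overlined); the size of a part $t$ or $\overline{t}$ is $t$, and the weight $|\pi|$ is the sum of the sizes of the parts. $\mathcal{G}_O^{N}$ is the set of overpartitions in which at least one non-overlined part appears and the sizes of all non-overlined parts are greater than the sizes of all overlined parts (if any). Here $|q|<1$ (or $q$ is a formal variable), $(a;q)_\infty=\prod_{i=0}^{\infty}(1-aq^i)$ and $(a;q)_n=\prod_{i=0}^{n-1}(1-aq^i)$. -}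

module Defs where

open import Data.Bool using (Bool; true; false; T)
open import Data.Bool.Properties using (T?)
open import Data.Integer as ℤ using (ℤ; 0ℤ; 1ℤ)
import Data.Integer.Properties as ℤ
open import Data.List using (List; []; _∷_; length; map; sum; filter; upTo; cartesianProductWith)
open import Data.List.Membership.Propositional using (_∈_)
open import Data.List.Membership.Propositional.Properties
  using (∈-cartesianProductWith⁺; ∈-cartesianProductWith⁻; ∈-filter⁺; ∈-filter⁻; ∈-upTo⁺)
open import Data.List.Relation.Unary.All as All using (All; []; _∷_; all?)
open import Data.List.Relation.Unary.AllPairs as AllPairs using (AllPairs; allPairs?; []; _∷_)
open import Data.List.Relation.Unary.Any using (Any; any?; here; there)
open import Data.List.Relation.Unary.Linked using (Linked; linked?)
open import Data.List.Relation.Unary.Unique.Propositional using (Unique)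
import Data.List.Relation.Unary.Unique.Propositional.Properties as Unique
open import Data.Nat using (ℕ; zero; suc; _+_; _*_; _∸_; _≤_; _<_; _≥_; z≤n; s≤s; _≤?_; _<?_; _≟_)
import Data.Nat.Properties as ℕ
open import Data.Product using (Σ-syntax; _×_; _,_; proj₁; proj₂)
open import Data.Sum using (inj₁; inj₂)
open import Data.Vec using (Vec; []; _∷_; head)
open import Function using (_∘_; _⇔_; mk⇔)
open import Relation.Binary.PropositionalEquality
  using (_≡_; refl; sym; trans; cong; cong₂; subst; module ≡-Reasoning)
open import Relation.Nullary using (¬_)
open import Relation.Nullary.Decidable using (map′; _×-dec_; _→-dec_; ¬?)
open import Relation.Unary using (Decidable)

-- Formal power series in q over ℤ, as coefficient sequences
Series : Set
Series = ℕ → ℤ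

infix 4 _≋_

_≋_ : Series → Series → Set
f ≋ g = ∀ m → f m ≡ g m

∑< : ℕ → (ℕ → ℤ) → ℤ
∑< zero    c = 0ℤ
∑< (suc n) c = c 0 ℤ.+ ∑< n (c ∘ suc)

infixl 6 _⊕_ _⊖_
infixl 7 _⊛_
infixr 8 _^_
infix  8 ⊝_
infix  9 _⁻¹

0ₛ 1ₛ q : Series
0ₛ _ = 0ℤ

1ₛ zero    = 1ℤ
1ₛ (suc _) = 0ℤ

q zero    = 0ℤ
q (suc m) = 1ₛ m

⊝_ : Series → Series
(⊝ f) m = ℤ.- f m

_⊕_ _⊖_ _⊛_ : Series → Series → Series
(f ⊕ g) m = f m ℤ.+ g m
(f ⊖ g) m = f m ℤ.- g m
(f ⊛ g) m = ∑< (suc m) (λ i → f i ℤ.* g (m ∸ i))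

_^_ : Series → ℕ → Series
f ^ zero  = 1ₛ
f ^ suc n = f ⊛ f ^ n

-- The multiplicative inverse of a series f with constant term 1: the
-- coefficients g m of f ⁻¹ satisfy g 0 = 1 and
--   g (m + 1) = - (f 1 · g m + f 2 · g (m - 1) + ⋯ + f (m + 1) · g 0).
-- The value is meaningless for other constant terms; see ⁻¹-inverseʳ and the
-- lemmas on constant terms below.

dot : ∀ {n} → (ℕ → ℤ) → Vec ℤ n → ℤ
dot c []       = 0ℤ
dot c (x ∷ xs) = c 0 ℤ.* x ℤ.+ dot (c ∘ suc) xs

-- g m ∷ g (m - 1) ∷ ⋯ ∷ g 0 ∷ []
inverseCoeffs : Series → ∀ m → Vec ℤ (suc m)
inverseCoeffs f zero    = 1ℤ ∷ []
inverseCoeffs f (suc m) = (ℤ.- dot (f ∘ suc) gs) ∷ gs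
  where gs = inverseCoeffs f m

_⁻¹ : Series → Series
(f ⁻¹) m = head (inverseCoeffs f m)

dot-inverseCoeffs : ∀ c f m → dot c (inverseCoeffs f m) ≡ (c ⊛ f ⁻¹) m
dot-inverseCoeffs c f zero    = refl
dot-inverseCoeffs c f (suc m) =
  cong (ℤ._+_ (c 0 ℤ.* (f ⁻¹) (suc m))) (dot-inverseCoeffs (c ∘ suc) f m)

⁻¹-inverseʳ : ∀ f → f 0 ≡ 1ℤ → f ⊛ f ⁻¹ ≋ 1ₛ
⁻¹-inverseʳ f f₀≡1 zero    = cong (λ x → x ℤ.* 1ℤ ℤ.+ 0ℤ) f₀≡1
⁻¹-inverseʳ f f₀≡1 (suc m) = begin
  f 0 ℤ.* (ℤ.- d) ℤ.+ (f ∘ suc ⊛ f ⁻¹) m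
    ≡⟨ cong₂ (λ x y → x ℤ.* (ℤ.- d) ℤ.+ y) f₀≡1 (sym (dot-inverseCoeffs (f ∘ suc) f m)) ⟩
  1ℤ ℤ.* (ℤ.- d) ℤ.+ d
    ≡⟨ cong (ℤ._+ d) (ℤ.*-identityˡ (ℤ.- d)) ⟩
  (ℤ.- d) ℤ.+ d
    ≡⟨ ℤ.+-inverseˡ d ⟩
  0ℤ ∎
  where
  open ≡-Reasoning
  d = dot (f ∘ suc) (inverseCoeffs f m)

Convergent : (ℕ → Series) → Set
Convergent s = ∀ m → Σ[ N ∈ ℕ ] (∀ n → N ≤ n → s n m ≡ s N m)

lim : (s : ℕ → Series) → Convergent s → Series
lim s conv m = s (proj₁ (conv m)) m

∑-partial : ℕ → (ℕ → Series) → ℕ → Series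
∑-partial a f zero    = 0ₛ
∑-partial a f (suc k) = ∑-partial a f k ⊕ f (a + k)

-- The sum of f n over all n ≥ a
∑≥ : (a : ℕ) (f : ℕ → Series) → Convergent (∑-partial a f) → Series
∑≥ a f = lim (∑-partial a f)

-- f is divisible by qⁿ
Order≥ : ℕ → Series → Set
Order≥ n f = ∀ m → m < n → f m ≡ 0ℤ

stable⇒convergent : ∀ s → (∀ m n → m < n → s (suc n) m ≡ s n m) → Convergent s
stable⇒convergent s stable m = suc m , go
  where
  go : ∀ n → suc m ≤ n → s n m ≡ s (suc m) m
  go (suc n) m<1+n with ℕ.m≤n⇒m<n∨m≡n m<1+n
  ... | inj₁ (s≤s m<n) = trans (stable m n m<n) (go n m<n)
  ... | inj₂ refl      = refl

summable : ∀ a f → (∀ n → Order≥ n (f n)) → Convergent (∑-partial a f)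
summable a f ord = stable⇒convergent _ λ m k m<k →
  trans (cong (ℤ._+_ (∑-partial a f k m)) (ord (a + k) m (ℕ.≤-trans m<k (ℕ.m≤n+m k a))))
        (ℤ.+-identityʳ _)

∑<-cong : ∀ n {c d : ℕ → ℤ} → (∀ i → i < n → c i ≡ d i) → ∑< n c ≡ ∑< n d
∑<-cong zero    c≡d = refl
∑<-cong (suc n) c≡d =
  cong₂ ℤ._+_ (c≡d 0 (s≤s z≤n)) (∑<-cong n λ i i<n → c≡d (suc i) (s≤s i<n))

∑<-zero : ∀ n → ∑< n (λ _ → 0ℤ) ≡ 0ℤ
∑<-zero zero    = refl
∑<-zero (suc n) = trans (ℤ.+-identityˡ _) (∑<-zero n)

⊛-identityʳ : ∀ f → f ⊛ 1ₛ ≋ f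
⊛-identityʳ f zero    = trans (ℤ.+-identityʳ _) (ℤ.*-identityʳ (f 0))
⊛-identityʳ f (suc m) =
  trans (cong₂ ℤ._+_ (ℤ.*-zeroʳ (f 0)) (⊛-identityʳ (f ∘ suc) m)) (ℤ.+-identityˡ _)

⊛-congʳ-below : ∀ f {g h} m → (∀ j → j ≤ m → g j ≡ h j) → (f ⊛ g) m ≡ (f ⊛ h) m
⊛-congʳ-below f m g≡h =
  ∑<-cong (suc m) λ i _ → cong (ℤ._*_ (f i)) (g≡h (m ∸ i) (ℕ.m∸n≤m m i))

order-⊛ʳ : ∀ {n} f {g} → Order≥ n g → Order≥ n (f ⊛ g)
order-⊛ʳ f ord m m<n = trans
  (⊛-congʳ-below f {h = 0ₛ} m λ j j≤m → ord j (ℕ.≤-<-trans j≤m m<n))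
  (trans (∑<-cong (suc m) λ i _ → ℤ.*-zeroʳ (f i)) (∑<-zero (suc m)))

order-⊛ˡ : ∀ {n f} g → Order≥ n f → Order≥ n (f ⊛ g)
order-⊛ˡ g ord m m<n = trans
  (∑<-cong (suc m) λ { i (s≤s i≤m) →
    trans (cong (ℤ._* g (m ∸ i)) (ord i (ℕ.≤-<-trans i≤m m<n))) (ℤ.*-zeroˡ (g (m ∸ i))) })
  (∑<-zero (suc m))

order-q^ : ∀ n → Order≥ n (q ^ n)
order-q^ (suc n) zero    _         = trans (ℤ.+-identityʳ _) (ℤ.*-zeroˡ ((q ^ n) 0))
order-q^ (suc n) (suc m) (s≤s m<n) = begin
  0ℤ ℤ.* (q ^ n) (suc m) ℤ.+ (1ₛ ⊛ q ^ n) m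
    ≡⟨ cong₂ ℤ._+_ (ℤ.*-zeroˡ ((q ^ n) (suc m))) (order-⊛ʳ 1ₛ (order-q^ n) m m<n) ⟩
  0ℤ ∎
  where open ≡-Reasoning

-- (a ; b)ₙ = (1 - a)(1 - ab)⋯(1 - abⁿ⁻¹)
⟨_⨾_⟩_ : Series → Series → ℕ → Series
⟨ a ⨾ b ⟩ zero  = 1ₛ
⟨ a ⨾ b ⟩ suc n = ⟨ a ⨾ b ⟩ n ⊛ (1ₛ ⊖ a ⊛ b ^ n)

⟨⨾q⟩-convergent : ∀ a → Convergent ⟨ a ⨾ q ⟩_
⟨⨾q⟩-convergent a = stable⇒convergent _ λ m n m<n → trans
  (⊛-congʳ-below (⟨ a ⨾ q ⟩ n) {h = 1ₛ} m λ j j≤m → trans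
    (cong (λ x → 1ₛ j ℤ.- x) (order-⊛ʳ a (order-q^ n) j (ℕ.≤-<-trans j≤m m<n)))
    (ℤ.+-identityʳ (1ₛ j)))
  (⊛-identityʳ (⟨ a ⨾ q ⟩ n) m)

-- (a ; q)∞
⟨_⨾q⟩∞ : Series → Series
⟨ a ⨾q⟩∞ = lim ⟨ a ⨾ q ⟩_ (⟨⨾q⟩-convergent a)

-- All series to which _⁻¹ is applied below and in the theorem have constant term 1.

⟨⨾⟩-constant : ∀ a b n → a 0 ≡ 0ℤ → (⟨ a ⨾ b ⟩ n) 0 ≡ 1ℤ
⟨⨾⟩-constant a b zero    a₀≡0 = refl
⟨⨾⟩-constant a b (suc n) a₀≡0 = cong₂ (λ x y → x ℤ.* (1ℤ ℤ.- (y ℤ.+ 0ℤ)) ℤ.+ 0ℤ)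
  (⟨⨾⟩-constant a b n a₀≡0)
  (trans (cong (ℤ._* (b ^ n) 0) a₀≡0) (ℤ.*-zeroˡ ((b ^ n) 0)))

⟨⨾q⟩∞-constant : ∀ a → a 0 ≡ 0ℤ → ⟨ a ⨾q⟩∞ 0 ≡ 1ℤ
⟨⨾q⟩∞-constant a = ⟨⨾⟩-constant a q 1

1-q^-constant : ∀ n → 0 < n → (1ₛ ⊖ q ^ n) 0 ≡ 1ℤ
1-q^-constant n 0<n = cong (λ x → 1ℤ ℤ.- x) (order-q^ n 0 0<n)

record Part : Set where
  constructor part
  field
    size      : ℕ
    overlined : Bool

open Part public

Overlined : Part → Set
Overlined p = T (overlined p)

record IsOverpartition (π : List Part) : Set where
  constructor isOverpartition
  field
    positive      : All (λ p → 0 < size p) π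
    nonIncreasing : Linked (λ p r → size p ≥ size r) π
    -- a part preceded by another one of the same size is not overlined
    firstOnly     : AllPairs (λ p r → size p ≡ size r → ¬ Overlined r) π

weight : List Part → ℕ
weight π = sum (map size π)

record 𝒢ᴺ (π : List Part) : Set where
  constructor 𝒢ᴺ-intro
  field
    overpartition     : IsOverpartition π
    someNonOverlined  : Any (λ p → ¬ Overlined p) π
    nonOverlinedAbove : All (λ p → All (λ r → ¬ Overlined p → Overlined r → size r < size p) π) π

isOverpartition? : Decidable IsOverpartition
isOverpartition? π = map′ (λ { (a , b , c) → isOverpartition a b c })
  (λ { (isOverpartition a b c) → a , b , c })
  (all? (λ p → 0 <? size p) π
    ×-dec linked? (λ p r → size r ≤? size p) π
    ×-dec allPairs? (λ p r → (size p ≟ size r) →-dec ¬? (T? (overlined r))) π)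

𝒢ᴺ? : Decidable 𝒢ᴺ
𝒢ᴺ? π = map′ (λ { (a , b , c) → 𝒢ᴺ-intro a b c }) (λ { (𝒢ᴺ-intro a b c) → a , b , c })
  (isOverpartition? π
    ×-dec any? (λ p → ¬? (T? (overlined p))) π
    ×-dec all? (λ p → all? (λ r →
      ¬? (T? (overlined p)) →-dec (T? (overlined r) →-dec (size r <? size p))) π) π)

-- An overpartition of weight n has at most n parts, each of size at most n, so
-- the overpartitions of n are found among the lists of that shape;
-- ∈-overpartitions and overpartitions-unique show that each one is listed
-- exactly once.

parts≤ : ℕ → List Part
parts≤ n = cartesianProductWith part (upTo (suc n)) (false ∷ true ∷ [])

lists≤ : List Part → ℕ → List (List Part)
lists≤ ps zero    = [] ∷ []
lists≤ ps (suc k) = [] ∷ cartesianProductWith _∷_ ps (lists≤ ps k)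

OverpartitionOf : ℕ → List Part → Set
OverpartitionOf n π = IsOverpartition π × weight π ≡ n

overpartitionOf? : ∀ n → Decidable (OverpartitionOf n)
overpartitionOf? n π = isOverpartition? π ×-dec (weight π ≟ n)

overpartitions : ℕ → List (List Part)
overpartitions n = filter (overpartitionOf? n) (lists≤ (parts≤ n) n)

∈-parts≤ : ∀ {n} p → size p ≤ n → p ∈ parts≤ n
∈-parts≤ (part t b) t≤n = ∈-cartesianProductWith⁺ part (∈-upTo⁺ (s≤s t≤n)) (∈-bools b)
  where
  ∈-bools : ∀ b → b ∈ (false ∷ true ∷ [])
  ∈-bools false = here refl
  ∈-bools true  = there (here refl)

∈-lists≤ : ∀ {ps} k {π} → All (_∈ ps) π → length π ≤ k → π ∈ lists≤ ps k
∈-lists≤ zero    []       _         = here refl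
∈-lists≤ (suc k) []       _         = here refl
∈-lists≤ (suc k) (p∈ ∷ a) (s≤s l≤k) = there (∈-cartesianProductWith⁺ _∷_ p∈ (∈-lists≤ k a l≤k))

length≤weight : ∀ {π} → All (λ p → 0 < size p) π → length π ≤ weight π
length≤weight []         = z≤n
length≤weight (0<t ∷ 0<) = ℕ.+-mono-≤ 0<t (length≤weight 0<)

sizes≤weight : ∀ π → All (λ p → size p ≤ weight π) π
sizes≤weight []      = []
sizes≤weight (p ∷ π) = ℕ.m≤m+n (size p) (weight π)
  ∷ All.map (λ t≤ → ℕ.≤-trans t≤ (ℕ.m≤n+m (weight π) (size p))) (sizes≤weight π)

∈-overpartitions : ∀ n π → π ∈ overpartitions n ⇔ OverpartitionOf n π
∈-overpartitions n π = mk⇔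
  (λ π∈ → proj₂ (∈-filter⁻ (overpartitionOf? n) {xs = lists≤ (parts≤ n) n} π∈))
  λ { (isO , refl) → ∈-filter⁺ (overpartitionOf? n)
    (∈-lists≤ n (All.map (λ {p} → ∈-parts≤ p) (sizes≤weight π))
      (length≤weight (IsOverpartition.positive isO)))
    (isO , refl) }

parts≤-unique : ∀ n → Unique (parts≤ n)
parts≤-unique n = Unique.cartesianProductWith⁺ part (λ { refl → refl , refl })
  (Unique.upTo⁺ (suc n)) (((λ ()) ∷ []) ∷ [] ∷ [])

lists≤-unique : ∀ {ps} → Unique ps → ∀ k → Unique (lists≤ ps k)
lists≤-unique      u zero    = [] ∷ []
lists≤-unique {ps} u (suc k) =
  All.tabulate (λ π∈ → nonempty (∈-cartesianProductWith⁻ _∷_ ps (lists≤ ps k) π∈))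
  ∷ Unique.cartesianProductWith⁺ _∷_ (λ { refl → refl , refl }) u (lists≤-unique u k)
  where
  nonempty : ∀ {π : List Part} {A B : Part → List Part → Set} →
    Σ[ p ∈ Part ] Σ[ ρ ∈ List Part ] A p ρ × B p ρ × π ≡ p ∷ ρ → ¬ [] ≡ π
  nonempty (_ , _ , _ , _ , refl) ()

overpartitions-unique : ∀ n → Unique (overpartitions n)
overpartitions-unique n =
  Unique.filter⁺ (overpartitionOf? n) (lists≤-unique (parts≤-unique n) n)

-- The sum of q^|π| over the overpartitions π satisfying P: its coefficient at
-- qⁿ is the number of such π of weight n.
genFun : {P : List Part → Set} → Decidable P → Series
genFun P? n = ℤ.+ length (filter P? (overpartitions n))

summable₁ : Convergent (∑-partial 1 λ n → q ^ n ⊛ ⟨ q ^ 2 ⨾ q ^ 2 ⟩ (n ∸ 1))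
summable₁ = summable 1 _ λ n → order-⊛ˡ (⟨ q ^ 2 ⨾ q ^ 2 ⟩ (n ∸ 1)) (order-q^ n)

summable₂ : Convergent (∑-partial 0 λ n →
  q ^ (2 * n + 1) ⊛ (1ₛ ⊖ q ^ (2 * n + 1)) ⁻¹ ⊛ (⟨ q ^ 2 ⨾ q ^ 2 ⟩ n) ⁻¹)
summable₂ = summable 0 _ λ n →
  order-⊛ˡ ((⟨ q ^ 2 ⨾ q ^ 2 ⟩ n) ⁻¹) (order-⊛ˡ ((1ₛ ⊖ q ^ (2 * n + 1)) ⁻¹)
    λ m m<n → order-q^ (2 * n + 1) m
      (ℕ.≤-trans m<n (ℕ.≤-trans (ℕ.m≤m+n n (n + 0)) (ℕ.m≤m+n (2 * n) 1))))

{-# OPTIONS --safe #-}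
-- Let G_t and D_t count the members of 𝒢ᴺ, respectively the overpartitions with
-- only overlined parts, whose parts are all at most t. Looking at the first part
-- gives D_{t+1} = (1 + q^{t+1}) D_t, so D_t = (-q;q)_t, and
-- G_{t+1} = G_t + q^{t+1} (G_{t+1} + D_t). Multiplying the latter by (q;q)_t turns it
-- into a telescoping relation for (q;q)_t G_t, which is the first identity.
--
-- For the second identity let F(x) = ∑_k x^k / (q²;q²)_k. Then
-- F(q² x) = (1 - x) F(x), whence (q²;q²)_{n-1} = (q²;q²)_∞ F(q^{2n}). Expanding F
-- and summing over n first leaves geometric series with ratio q^{2k+1}.
module Submission where

open import Algebra.Bundles using (CommutativeRing)
import Algebra.Solver.Ring as RingSolver
open import Algebra.Solver.Ring.AlmostCommutativeRing
  using (AlmostCommutativeRing; fromCommutativeRing; _-Raw-AlmostCommutative⟶_)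
import Data.Bool.Properties as Bool
open import Data.Bool using (true; false)
open import Data.Empty using (⊥; ⊥-elim)
open import Data.Integer as ℤ using (ℤ; 0ℤ; 1ℤ)
import Data.Integer.Properties as ℤ
open import Data.Integer.Solver using (module +-*-Solver)
open import Data.List using (List; []; _∷_; _++_; length; map; filter)
open import Data.List.Membership.Propositional using (_∈_; find)
open import Data.List.Membership.Propositional.Properties
  using (∈-filter⁺; ∈-filter⁻; ∈-map⁺; ∈-map⁻; ∈-++⁺ˡ; ∈-++⁺ʳ; ∈-++⁻)
open import Data.List.Membership.Propositional.Properties.WithK using (unique∧set⇒bag)
import Data.List.Properties as List
open import Data.List.Relation.Binary.BagAndSetEquality using (∼bag⇒↭)
open import Data.List.Relation.Binary.Permutation.Propositional.Properties using (↭-length)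
open import Data.List.Relation.Unary.All as All using (All; []; _∷_; all?)
open import Data.List.Relation.Unary.All.Properties using (¬Any⇒All¬)
open import Data.List.Relation.Unary.AllPairs using ([]; _∷_)
open import Data.List.Relation.Unary.Any using (Any; any?; here; there)
open import Data.List.Relation.Unary.Linked as Linked using (Linked; []; [-]; _∷_)
import Data.List.Relation.Unary.Linked.Properties as Linked
open import Data.List.Relation.Unary.Unique.Propositional using (Unique)
import Data.List.Relation.Unary.Unique.Propositional.Properties as Unique
open import Data.Maybe using (Maybe; just; nothing)
open import Data.Nat using (ℕ; zero; suc; _+_; _*_; _∸_; _≤_; _<_; _≥_; z≤n; s≤s; _≤?_; _≟_)
import Data.Nat.Properties as ℕ
import Data.Nat.Solver as ℕ
open import Data.Product using (_×_; _,_; proj₁; proj₂; ∃-syntax)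
open import Data.Sum using (inj₁; inj₂; [_,_]′)
open import Data.Unit using (tt)
open import Function using (_∘_; id; _⇔_; mk⇔; Equivalence)
open import Level using (0ℓ)
open import Relation.Binary using (IsEquivalence)
open import Relation.Binary.PropositionalEquality
  using (_≡_; refl; sym; trans; cong; cong₂; subst; module ≡-Reasoning)
open import Relation.Nullary using (¬_; Dec; yes; no)
open import Relation.Nullary.Decidable using (map′; _×-dec_; ¬?; decidable-stable)
open import Relation.Unary using (Decidable; _∪_; _∩_)
open import Relation.Unary.Properties using (_∪?_; _∩?_)
open import Defs

-- The ring of formal power series

infixr 7 _·_
_·_ : ℤ → Series → Series
(c · f) m = c ℤ.* f m

⊛-cong : ∀ {f f′ g g′} m → (∀ i → i ≤ m → f i ≡ f′ i) → (∀ i → i ≤ m → g i ≡ g′ i) →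
  (f ⊛ g) m ≡ (f′ ⊛ g′) m
⊛-cong m f≡ g≡ = ∑<-cong (suc m) λ { i (s≤s i≤m) →
  cong₂ ℤ._*_ (f≡ i i≤m) (g≡ (m ∸ i) (ℕ.m∸n≤m m i)) }

⊛-distribʳ : ∀ h f g → (f ⊕ g) ⊛ h ≋ f ⊛ h ⊕ g ⊛ h
⊛-distribʳ h f g zero = lemma (f 0) (g 0) (h 0)
  where
  open +-*-Solver
  lemma : ∀ a b c → (a ℤ.+ b) ℤ.* c ℤ.+ 0ℤ ≡ a ℤ.* c ℤ.+ 0ℤ ℤ.+ (b ℤ.* c ℤ.+ 0ℤ)
  lemma = solve 3 (λ a b c → (a :+ b) :* c :+ con 0ℤ := a :* c :+ con 0ℤ :+ (b :* c :+ con 0ℤ)) refl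
⊛-distribʳ h f g (suc m) = trans
  (cong (ℤ._+_ ((f 0 ℤ.+ g 0) ℤ.* h (suc m))) (⊛-distribʳ h (f ∘ suc) (g ∘ suc) m))
  (lemma (f 0) (g 0) (h (suc m)) _ _)
  where
  open +-*-Solver
  lemma : ∀ a b c x y →
    (a ℤ.+ b) ℤ.* c ℤ.+ (x ℤ.+ y) ≡ a ℤ.* c ℤ.+ x ℤ.+ (b ℤ.* c ℤ.+ y)
  lemma = solve 5 (λ a b c x y → (a :+ b) :* c :+ (x :+ y) := a :* c :+ x :+ (b :* c :+ y)) refl

·-⊛-assoc : ∀ c f g → (c · f) ⊛ g ≋ c · (f ⊛ g)
·-⊛-assoc c f g zero = lemma c (f 0) (g 0)
  where
  open +-*-Solver
  lemma : ∀ c a b → c ℤ.* a ℤ.* b ℤ.+ 0ℤ ≡ c ℤ.* (a ℤ.* b ℤ.+ 0ℤ)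
  lemma = solve 3 (λ c a b → c :* a :* b :+ con 0ℤ := c :* (a :* b :+ con 0ℤ)) refl
·-⊛-assoc c f g (suc m) = trans
  (cong (ℤ._+_ (c ℤ.* f 0 ℤ.* g (suc m))) (·-⊛-assoc c (f ∘ suc) g m))
  (lemma c (f 0) (g (suc m)) _)
  where
  open +-*-Solver
  lemma : ∀ c a b x → c ℤ.* a ℤ.* b ℤ.+ c ℤ.* x ≡ c ℤ.* (a ℤ.* b ℤ.+ x)
  lemma = solve 4 (λ c a b x → c :* a :* b :+ c :* x := c :* (a :* b :+ x)) refl

-- Induction on the coefficient index. By definition `(f ⊛ g) ∘ suc` is
-- `f 0 · (g ∘ suc) ⊕ (f ∘ suc) ⊛ g`, so the shifted product is again built from products;
-- distributivity and `·-⊛-assoc` then reduce the claim to index `m`.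
⊛-assoc : ∀ f g h → (f ⊛ g) ⊛ h ≋ f ⊛ (g ⊛ h)
⊛-assoc f g h zero = lemma (f 0) (g 0) (h 0)
  where
  open +-*-Solver
  lemma : ∀ a b c → (a ℤ.* b ℤ.+ 0ℤ) ℤ.* c ℤ.+ 0ℤ ≡ a ℤ.* (b ℤ.* c ℤ.+ 0ℤ) ℤ.+ 0ℤ
  lemma = solve 3 (λ a b c →
    (a :* b :+ con 0ℤ) :* c :+ con 0ℤ := a :* (b :* c :+ con 0ℤ) :+ con 0ℤ) refl
⊛-assoc f g h (suc m) = begin
  (f ⊛ g) 0 ℤ.* h (suc m) ℤ.+ ((f 0 · (g ∘ suc) ⊕ (f ∘ suc) ⊛ g) ⊛ h) m
    ≡⟨ cong (ℤ._+_ ((f ⊛ g) 0 ℤ.* h (suc m))) (begin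
      ((f 0 · (g ∘ suc) ⊕ (f ∘ suc) ⊛ g) ⊛ h) m
        ≡⟨ ⊛-distribʳ h (f 0 · (g ∘ suc)) ((f ∘ suc) ⊛ g) m ⟩
      ((f 0 · (g ∘ suc)) ⊛ h) m ℤ.+ (((f ∘ suc) ⊛ g) ⊛ h) m
        ≡⟨ cong₂ ℤ._+_ (·-⊛-assoc (f 0) (g ∘ suc) h m) (⊛-assoc (f ∘ suc) g h m) ⟩
      f 0 ℤ.* ((g ∘ suc) ⊛ h) m ℤ.+ ((f ∘ suc) ⊛ (g ⊛ h)) m ∎) ⟩
  (f ⊛ g) 0 ℤ.* h (suc m) ℤ.+ (f 0 ℤ.* ((g ∘ suc) ⊛ h) m ℤ.+ ((f ∘ suc) ⊛ (g ⊛ h)) m)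
    ≡⟨ lemma (f 0) (g 0) (h (suc m)) _ _ ⟩
  f 0 ℤ.* (g ⊛ h) (suc m) ℤ.+ ((f ∘ suc) ⊛ (g ⊛ h)) m ∎
  where
  open ≡-Reasoning
  open +-*-Solver
  lemma : ∀ a b c x y →
    (a ℤ.* b ℤ.+ 0ℤ) ℤ.* c ℤ.+ (a ℤ.* x ℤ.+ y) ≡ a ℤ.* (b ℤ.* c ℤ.+ x) ℤ.+ y
  lemma = solve 5 (λ a b c x y →
    (a :* b :+ con 0ℤ) :* c :+ (a :* x :+ y) := a :* (b :* c :+ x) :+ y) refl

-- `∑<` unfolds from the first summand; this peels off the last one, which is what commutativity
-- needs in order to match the two sides.
⊛-unfoldʳ : ∀ f g m → (f ⊛ g) (suc m) ≡ f (suc m) ℤ.* g 0 ℤ.+ (f ⊛ (g ∘ suc)) m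
⊛-unfoldʳ f g zero = lemma (f 0) (g 1) (f 1) (g 0)
  where
  open +-*-Solver
  lemma : ∀ a b c d →
    a ℤ.* b ℤ.+ (c ℤ.* d ℤ.+ 0ℤ) ≡ c ℤ.* d ℤ.+ (a ℤ.* b ℤ.+ 0ℤ)
  lemma = solve 4 (λ a b c d →
    a :* b :+ (c :* d :+ con 0ℤ) := c :* d :+ (a :* b :+ con 0ℤ)) refl
⊛-unfoldʳ f g (suc m) = trans
  (cong (ℤ._+_ (f 0 ℤ.* g (2 + m))) (⊛-unfoldʳ (f ∘ suc) g m))
  (lemma (f 0 ℤ.* g (2 + m)) (f (2 + m) ℤ.* g 0) (((f ∘ suc) ⊛ (g ∘ suc)) m))
  where
  open +-*-Solver
  lemma : ∀ x y z → x ℤ.+ (y ℤ.+ z) ≡ y ℤ.+ (x ℤ.+ z)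
  lemma = solve 3 (λ x y z → x :+ (y :+ z) := y :+ (x :+ z)) refl

⊛-comm : ∀ f g → f ⊛ g ≋ g ⊛ f
⊛-comm f g zero    = cong (ℤ._+ 0ℤ) (ℤ.*-comm (f 0) (g 0))
⊛-comm f g (suc m) = trans
  (cong₂ ℤ._+_ (ℤ.*-comm (f 0) (g (suc m))) (⊛-comm (f ∘ suc) g m))
  (sym (⊛-unfoldʳ g f m))

q⊛-suc : ∀ f m → (q ⊛ f) (suc m) ≡ f m
q⊛-suc f m = begin
  0ℤ ℤ.* f (suc m) ℤ.+ (1ₛ ⊛ f) m ≡⟨ cong₂ ℤ._+_ (ℤ.*-zeroˡ (f (suc m))) (⊛-comm 1ₛ f m) ⟩
  0ℤ ℤ.+ (f ⊛ 1ₛ) m               ≡⟨ ℤ.+-identityˡ _ ⟩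
  (f ⊛ 1ₛ) m                      ≡⟨ ⊛-identityʳ f m ⟩
  f m                             ∎
  where open ≡-Reasoning

q^⊛-shift : ∀ n f m → n ≤ m → (q ^ n ⊛ f) m ≡ f (m ∸ n)
q^⊛-shift zero    f m       _         = trans (⊛-comm 1ₛ f m) (⊛-identityʳ f m)
q^⊛-shift (suc n) f (suc m) (s≤s n≤m) = trans (⊛-assoc q (q ^ n) f (suc m))
  (trans (q⊛-suc (q ^ n ⊛ f) m) (q^⊛-shift n f m n≤m))

order-suc-⊛ : ∀ {n f g} → f 0 ≡ 0ℤ → Order≥ n g → Order≥ (suc n) (f ⊛ g)
order-suc-⊛ {g = g} f₀≡0 ord zero    _         =
  cong (ℤ._+ 0ℤ) (trans (cong (ℤ._* g 0) f₀≡0) (ℤ.*-zeroˡ (g 0)))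
order-suc-⊛ {f = f} {g} f₀≡0 ord (suc m) (s≤s m<n) = cong₂ ℤ._+_
  (trans (cong (ℤ._* g (suc m)) f₀≡0) (ℤ.*-zeroˡ (g (suc m))))
  (order-⊛ʳ (f ∘ suc) ord m m<n)

order-^ : ∀ {f} n → f 0 ≡ 0ℤ → Order≥ n (f ^ n)
order-^     zero    f₀≡0 _ ()
order-^ {f} (suc n) f₀≡0 = order-suc-⊛ {f = f} f₀≡0 (order-^ {f} n f₀≡0)

scalar : ℤ → Series
scalar c zero    = c
scalar c (suc _) = 0ℤ

scalar-⊛ : ∀ a b → scalar (a ℤ.* b) ≋ scalar a ⊛ scalar b
scalar-⊛ a b zero    = sym (ℤ.+-identityʳ (a ℤ.* b))
scalar-⊛ a b (suc m) = sym (cong₂ ℤ._+_ (ℤ.*-zeroʳ a)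
  (trans (⊛-comm 0ₛ (scalar b) m) (order-⊛ʳ (scalar b) {0ₛ} (λ _ _ → refl) m (ℕ.n<1+n m))))

-- scalar, except that constant 0ℤ and constant 1ℤ are 0ₛ and 1ₛ by definition:
-- this makes the numerals of the ring solver match those of Defs.
constant : ℤ → Series
constant (ℤ.+ 0) = 0ₛ
constant (ℤ.+ 1) = 1ₛ
constant c       = scalar c

constant≋scalar : ∀ c → constant c ≋ scalar c
constant≋scalar (ℤ.+ 0)           zero    = refl
constant≋scalar (ℤ.+ 0)           (suc m) = refl
constant≋scalar (ℤ.+ 1)           zero    = refl
constant≋scalar (ℤ.+ 1)           (suc m) = refl
constant≋scalar (ℤ.+ suc (suc _)) m       = refl
constant≋scalar ℤ.-[1+ _ ]        m       = refl

-- The ring ℤ⟦q⟧/(qᴹ), with series as representatives. In it the infinite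
-- sums and products of the theorem are finite.
module Truncated (M : ℕ) where

  infix 4 _≈_
  -- A record, so that `f` and `g` can be recovered from the type of a proof; a bare function type
  -- would show only the values `f m` and `g m`.
  record _≈_ (f g : Series) : Set where
    constructor agree
    field below : ∀ m → m < M → f m ≡ g m

  open _≈_ public

  ≋⇒≈ : ∀ {f g} → f ≋ g → f ≈ g
  ≋⇒≈ f≋g = agree λ m _ → f≋g m

  order⇒≈0 : ∀ {n f} → M ≤ n → Order≥ n f → f ≈ 0ₛ
  order⇒≈0 M≤n ord = agree λ m m<M → ord m (ℕ.<-≤-trans m<M M≤n)

  ≈-isEquivalence : IsEquivalence _≈_
  ≈-isEquivalence = record
    { refl  = agree λ _ _ → refl
    ; sym   = λ p → agree λ m m<M → sym (below p m m<M)
    ; trans = λ p r → agree λ m m<M → trans (below p m m<M) (below r m m<M)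
    }

  ⊛-cong-≈ : ∀ {f f′ g g′} → f ≈ f′ → g ≈ g′ → f ⊛ g ≈ f′ ⊛ g′
  ⊛-cong-≈ p r = agree λ m m<M → ⊛-cong m
    (λ i i≤m → below p i (ℕ.≤-<-trans i≤m m<M)) (λ i i≤m → below r i (ℕ.≤-<-trans i≤m m<M))

  ring : CommutativeRing 0ℓ 0ℓ
  ring = record
    { Carrier = Series ; _≈_ = _≈_ ; _+_ = _⊕_ ; _*_ = _⊛_ ; -_ = ⊝_ ; 0# = 0ₛ ; 1# = 1ₛ
    ; isCommutativeRing = record
      { isRing = record
        { +-isAbelianGroup = record
          { isGroup = record
            { isMonoid = record
              { isSemigroup = record
                { isMagma = record
                  { isEquivalence = ≈-isEquivalence
                  ; ∙-cong = λ p r → agree λ m m<M → cong₂ ℤ._+_ (below p m m<M) (below r m m<M)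
                  }
                ; assoc = λ f g h → ≋⇒≈ λ m → ℤ.+-assoc (f m) (g m) (h m)
                }
              ; identity = (λ f → ≋⇒≈ λ m → ℤ.+-identityˡ (f m))
                         , (λ f → ≋⇒≈ λ m → ℤ.+-identityʳ (f m))
              }
            ; inverse = (λ f → ≋⇒≈ λ m → ℤ.+-inverseˡ (f m))
                      , (λ f → ≋⇒≈ λ m → ℤ.+-inverseʳ (f m))
            ; ⁻¹-cong = λ p → agree λ m m<M → cong ℤ.-_ (below p m m<M)
            }
          ; comm = λ f g → ≋⇒≈ λ m → ℤ.+-comm (f m) (g m)
          }
        ; *-cong = ⊛-cong-≈
        ; *-assoc = λ f g h → ≋⇒≈ (⊛-assoc f g h)
        ; *-identity = (λ f → ≋⇒≈ λ m → trans (⊛-comm 1ₛ f m) (⊛-identityʳ f m))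
                     , (λ f → ≋⇒≈ (⊛-identityʳ f))
        ; distrib = (λ f g h → ≋⇒≈ λ m → trans (⊛-comm f (g ⊕ h) m)
                      (trans (⊛-distribʳ f g h m) (cong₂ ℤ._+_ (⊛-comm g f m) (⊛-comm h f m))))
                  , (λ f g h → ≋⇒≈ (⊛-distribʳ f g h))
        }
      ; *-comm = λ f g → ≋⇒≈ (⊛-comm f g)
      }
    }

  open CommutativeRing ring public
    using (setoid)
    renaming ( refl to ≈-refl; sym to ≈-sym; trans to ≈-trans
             ; +-cong to ⊕-cong; -‿cong to ⊝-cong; *-assoc to ⊛-assoc-≈; *-comm to ⊛-comm-≈
             ; *-identityˡ to ⊛-identityˡ-≈; *-identityʳ to ⊛-identityʳ-≈
             ; zeroʳ to ⊛-zeroʳ; distribˡ to ⊛-distribˡ-≈; +-identityˡ to ⊕-identityˡ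
             ; +-identityʳ to ⊕-identityʳ)

  almostRing : AlmostCommutativeRing 0ℓ 0ℓ
  almostRing = fromCommutativeRing ring

  constant-morphism :
    CommutativeRing.rawRing ℤ.+-*-commutativeRing -Raw-AlmostCommutative⟶ almostRing
  constant-morphism = record
    { ⟦_⟧    = constant
    ; +-homo = λ a b → via (a ℤ.+ b)
        (≈-trans (scalar-⊕ a b) (≈-sym (⊕-cong (constant≈ a) (constant≈ b))))
    ; *-homo = λ a b → via (a ℤ.* b)
        (≈-trans (≋⇒≈ (scalar-⊛ a b)) (≈-sym (⊛-cong-≈ (constant≈ a) (constant≈ b))))
    ; -‿homo = λ a → via (ℤ.- a) (≈-trans (scalar-⊝ a) (≈-sym (⊝-cong (constant≈ a))))
    ; 0-homo = ≈-refl
    ; 1-homo = ≈-refl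
    }
    where
    constant≈ : ∀ c → constant c ≈ scalar c
    constant≈ c = ≋⇒≈ (constant≋scalar c)
    via : ∀ c {f} → scalar c ≈ f → constant c ≈ f
    via c = ≈-trans (constant≈ c)
    scalar-⊕ : ∀ a b → scalar (a ℤ.+ b) ≈ scalar a ⊕ scalar b
    scalar-⊕ a b = ≋⇒≈ λ { zero → refl ; (suc _) → refl }
    scalar-⊝ : ∀ a → scalar (ℤ.- a) ≈ ⊝ scalar a
    scalar-⊝ a = ≋⇒≈ λ { zero → refl ; (suc _) → refl }

  constant≟ : ∀ a b → Maybe (constant a ≈ constant b)
  constant≟ a b with a ℤ.≟ b
  ... | yes refl = just (≋⇒≈ λ _ → refl)
  ... | no  _    = nothing

  module Solver = RingSolver _ almostRing constant-morphism constant≟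

  open Solver public using (solve; _:+_; _:*_; :-_; _:-_; _:=_; con)

  open import Relation.Binary.Reasoning.Setoid setoid

  -- Finite sums, powers and inverses modulo `q ^ M`

  ⊖-congˡ : ∀ f {g h} → g ≈ h → f ⊖ g ≈ f ⊖ h
  ⊖-congˡ f p = ⊕-cong (≈-refl {f}) (⊝-cong p)

  ⊛-congˡ : ∀ f {g h} → g ≈ h → f ⊛ g ≈ f ⊛ h
  ⊛-congˡ f = ⊛-cong-≈ (≈-refl {f})

  ⊛-congʳ : ∀ h {f g} → f ≈ g → f ⊛ h ≈ g ⊛ h
  ⊛-congʳ h p = ⊛-cong-≈ p (≈-refl {h})

  ⊕-congˡ : ∀ f {g h} → g ≈ h → f ⊕ g ≈ f ⊕ h
  ⊕-congˡ f = ⊕-cong (≈-refl {f})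

  ⊕-congʳ : ∀ h {f g} → f ≈ g → f ⊕ h ≈ g ⊕ h
  ⊕-congʳ h p = ⊕-cong p (≈-refl {h})

  ∑-cong : ∀ {a f g} n → (∀ k → f (a + k) ≈ g (a + k)) → ∑-partial a f n ≈ ∑-partial a g n
  ∑-cong zero    f≈g = ≈-refl
  ∑-cong (suc n) f≈g = ⊕-cong (∑-cong n f≈g) (f≈g n)

  ⊛-∑ : ∀ c a f n → c ⊛ ∑-partial a f n ≈ ∑-partial a (λ k → c ⊛ f k) n
  ⊛-∑ c a f zero    = ⊛-zeroʳ c
  ⊛-∑ c a f (suc n) = ≈-trans (⊛-distribˡ-≈ c _ _) (⊕-cong (⊛-∑ c a f n) ≈-refl)

  ∑-zero : ∀ a n → ∑-partial a (λ _ → 0ₛ) n ≈ 0ₛ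
  ∑-zero a zero    = ≈-refl
  ∑-zero a (suc n) = ≈-trans (⊕-identityʳ _) (∑-zero a n)

  ∑-⊕ : ∀ a f g n → ∑-partial a (λ k → f k ⊕ g k) n ≈ ∑-partial a f n ⊕ ∑-partial a g n
  ∑-⊕ a f g zero    = ≈-sym (⊕-identityʳ 0ₛ)
  ∑-⊕ a f g (suc n) = ≈-trans (⊕-cong (∑-⊕ a f g n) ≈-refl)
    (solve 4 (λ s t x y → (s :+ t) :+ (x :+ y) := (s :+ x) :+ (t :+ y)) ≈-refl
      (∑-partial a f n) (∑-partial a g n) (f (a + n)) (g (a + n)))

  ∑-swap : ∀ a b (f : ℕ → ℕ → Series) m n →
    ∑-partial a (λ i → ∑-partial b (f i) n) m ≈ ∑-partial b (λ j → ∑-partial a (λ i → f i j) m) n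
  ∑-swap a b f zero    n = ≈-sym (∑-zero b n)
  ∑-swap a b f (suc m) n = ≈-trans (⊕-cong (∑-swap a b f m n) ≈-refl)
    (≈-sym (∑-⊕ b (λ j → ∑-partial a (λ i → f i j) m) (f (a + m)) n))

  ^-+ : ∀ f m n → f ^ (m + n) ≈ f ^ m ⊛ f ^ n
  ^-+ f zero    n = ≈-sym (⊛-identityˡ-≈ _)
  ^-+ f (suc m) n = ≈-trans (⊛-congˡ f (^-+ f m n)) (≈-sym (⊛-assoc-≈ f _ _))

  ^-* : ∀ f m n → (f ^ m) ^ n ≈ f ^ (n * m)
  ^-* f m zero    = ≈-refl
  ^-* f m (suc n) = ≈-trans (⊛-congˡ (f ^ m) (^-* f m n)) (≈-sym (^-+ f m (n * m)))

  ^-⊛ : ∀ f g n → (f ⊛ g) ^ n ≈ f ^ n ⊛ g ^ n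
  ^-⊛ f g zero    = ≈-sym (⊛-identityʳ-≈ 1ₛ)
  ^-⊛ f g (suc n) = ≈-trans (⊛-congˡ (f ⊛ g) (^-⊛ f g n))
    (solve 4 (λ f g a b → (f :* g) :* (a :* b) := (f :* a) :* (g :* b))
      ≈-refl f g (f ^ n) (g ^ n))

  ^-cong : ∀ {f g} n → f ≈ g → f ^ n ≈ g ^ n
  ^-cong zero    f≈g = ≈-refl
  ^-cong (suc n) f≈g = ⊛-cong-≈ f≈g (^-cong n f≈g)

  inverseʳ : ∀ {f} → f 0 ≡ 1ℤ → f ⊛ f ⁻¹ ≈ 1ₛ
  inverseʳ {f} f₀≡1 = ≋⇒≈ (⁻¹-inverseʳ f f₀≡1)

  inverse-unique : ∀ {f g h} → f ⊛ g ≈ h → f 0 ≡ 1ℤ → g ≈ h ⊛ f ⁻¹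
  inverse-unique {f} {g} {h} fg≈h f₀≡1 = begin
    g               ≈⟨ ⊛-identityʳ-≈ g ⟨
    g ⊛ 1ₛ          ≈⟨ ⊛-congˡ g (inverseʳ {f} f₀≡1) ⟨
    g ⊛ (f ⊛ f ⁻¹)  ≈⟨ solve 3 (λ f g i → g :* (f :* i) := (f :* g) :* i) ≈-refl f g (f ⁻¹) ⟩
    (f ⊛ g) ⊛ f ⁻¹  ≈⟨ ⊛-congʳ (f ⁻¹) fg≈h ⟩
    h ⊛ f ⁻¹        ∎

  -- No need to follow the recursion for the coefficients of an inverse: `f ⁻¹` also inverts `g`,
  -- and inverses are unique.
  ⁻¹-cong : ∀ {f g} → f 0 ≡ 1ℤ → g 0 ≡ 1ℤ → f ≈ g → f ⁻¹ ≈ g ⁻¹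
  ⁻¹-cong {f} {g} f₀≡1 g₀≡1 f≈g = ≈-trans
    (inverse-unique {g} (≈-trans (⊛-congʳ (f ⁻¹) (≈-sym f≈g)) (inverseʳ {f} f₀≡1)) g₀≡1)
    (⊛-identityˡ-≈ (g ⁻¹))

  -- Coefficient `m` is settled from stage `suc m` on, so all coefficients below `M` can be read off
  -- at the single stage `M`.
  lim≈ : ∀ {s} conv → (∀ m → proj₁ (conv m) ≡ suc m) → lim s conv ≈ s M
  lim≈ {s} conv stage = agree λ m m<M →
    sym (proj₂ (conv m) M (subst (_≤ M) (sym (stage m)) m<M))

  geometric : ∀ x n → (1ₛ ⊖ x) ⊛ ∑-partial 1 (x ^_) n ⊕ x ^ suc n ≈ x
  geometric x zero    =
    solve 1 (λ x → (con 1ℤ :- x) :* con 0ℤ :+ x :* con 1ℤ := x) ≈-refl x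
  geometric x (suc n) = ≈-trans
    (solve 3 (λ x s p → (con 1ℤ :- x) :* (s :+ p) :+ x :* p := (con 1ℤ :- x) :* s :+ p)
      ≈-refl x (∑-partial 1 (x ^_) n) (x ^ suc n))
    (geometric x n)

  -- Since `x` has no constant term, the remainder `x ^ suc n` is divisible by `q ^ suc n` and
  -- vanishes in the truncated ring.
  geometric-inverse : ∀ {x n} → x 0 ≡ 0ℤ → (1ₛ ⊖ x) 0 ≡ 1ℤ → M ≤ n →
    ∑-partial 1 (x ^_) n ≈ x ⊛ (1ₛ ⊖ x) ⁻¹
  geometric-inverse {x} {n} x₀≡0 c M≤n = inverse-unique {1ₛ ⊖ x} (begin
    (1ₛ ⊖ x) ⊛ ∑-partial 1 (x ^_) n
      ≈⟨ ⊕-identityʳ _ ⟨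
    (1ₛ ⊖ x) ⊛ ∑-partial 1 (x ^_) n ⊕ 0ₛ
      ≈⟨ ⊕-congˡ ((1ₛ ⊖ x) ⊛ ∑-partial 1 (x ^_) n)
           (order⇒≈0 (ℕ.m≤n⇒m≤1+n M≤n) (order-^ {x} (suc n) x₀≡0)) ⟨
    (1ₛ ⊖ x) ⊛ ∑-partial 1 (x ^_) n ⊕ x ^ suc n
      ≈⟨ geometric x n ⟩
    x ∎) c

  -- Euler's series `F` with denominators (y;y)_k

  module Euler (y : Series) (y₀≡0 : y 0 ≡ 0ℤ) where

    E e : ℕ → Series
    E n = ⟨ y ⨾ y ⟩ n
    e n = (E n) ⁻¹

    E-constant : ∀ n → E n 0 ≡ 1ℤ
    E-constant n = ⟨⨾⟩-constant y y n y₀≡0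

    -- The last factor of `E (suc n)` times `e (suc n)` is an inverse of `E n`.
    e-step : ∀ n → e n ≈ (1ₛ ⊖ y ^ suc n) ⊛ e (suc n)
    e-step n = ≈-sym (≈-trans
      (inverse-unique {E n} (≈-trans (≈-sym (⊛-assoc-≈ (E n) _ _))
        (inverseʳ {E (suc n)} (E-constant (suc n)))) (E-constant n))
      (⊛-identityˡ-≈ (e n)))

    F : ℕ → Series → Series
    F n x = ∑-partial 0 (λ k → x ^ k ⊛ e k) n

    -- For k ≥ 1 the k-th terms of F(x) and F(yx) differ by x^k (1 - y^k) / (y;y)_k, which is x
    -- times term k - 1 of F(x); for k = 0 they agree. Stopping the sum after `x` one term earlier
    -- makes the identity exact at every length.
    F-shift : ∀ n x → F (suc n) (y ⊛ x) ⊕ x ⊛ F n x ≈ F (suc n) x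
    F-shift zero    x = ≈-trans (⊕-congˡ (F 1 (y ⊛ x)) (⊛-zeroʳ x)) (⊕-identityʳ _)
    F-shift (suc n) x = begin
      (F (suc n) (y ⊛ x) ⊕ (y ⊛ x) ^ suc n ⊛ e′) ⊕ x ⊛ (F n x ⊕ x ^ n ⊛ e n)
        ≈⟨ ⊕-cong (⊕-congˡ (F (suc n) (y ⊛ x)) (⊛-congʳ e′ (^-⊛ y x (suc n))))
             (⊛-congˡ x (⊕-congˡ (F n x) (⊛-congˡ (x ^ n) (e-step n)))) ⟩
      (F (suc n) (y ⊛ x) ⊕ (y ^ suc n ⊛ x ^ suc n) ⊛ e′)
        ⊕ x ⊛ (F n x ⊕ x ^ n ⊛ ((1ₛ ⊖ y ^ suc n) ⊛ e′))
        ≈⟨ solve 6 (λ s p x t u e →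
             (s :+ (p :* (x :* u)) :* e) :+ x :* (t :+ u :* ((con 1ℤ :- p) :* e))
               := (s :+ x :* t) :+ (x :* u) :* e) ≈-refl
             (F (suc n) (y ⊛ x)) (y ^ suc n) x (F n x) (x ^ n) e′ ⟩
      (F (suc n) (y ⊛ x) ⊕ x ⊛ F n x) ⊕ x ^ suc n ⊛ e′
        ≈⟨ ⊕-cong (F-shift n x) ≈-refl ⟩
      F (suc n) x ⊕ x ^ suc n ⊛ e′ ∎
      where e′ = e (suc n)

    -- Replacing `F n x` by `F (suc n) x` in `F-shift` costs the term `x ^ suc n ⊛ e n`, which is
    -- zero modulo `q ^ M`.
    F-functional : ∀ {n x} → x 0 ≡ 0ℤ → M ≤ suc n → F (suc n) (y ⊛ x) ≈ (1ₛ ⊖ x) ⊛ F (suc n) x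
    F-functional {n} {x} x₀≡0 M≤1+n = begin
      F (suc n) (y ⊛ x)
        ≈⟨ solve 2 (λ a b → a := (a :+ b) :- b) ≈-refl (F (suc n) (y ⊛ x)) (x ⊛ F n x) ⟩
      (F (suc n) (y ⊛ x) ⊕ x ⊛ F n x) ⊖ x ⊛ F n x
        ≈⟨ ⊕-congʳ (⊝ (x ⊛ F n x)) (F-shift n x) ⟩
      F (suc n) x ⊖ x ⊛ F n x
        ≈⟨ ⊖-congˡ (F (suc n) x) (⊕-identityʳ (x ⊛ F n x)) ⟨
      F (suc n) x ⊖ (x ⊛ F n x ⊕ 0ₛ)
        ≈⟨ ⊖-congˡ (F (suc n) x) (⊕-congˡ (x ⊛ F n x)
             (order⇒≈0 M≤1+n (order-⊛ˡ (e n) (order-^ {x} (suc n) x₀≡0)))) ⟨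
      F (suc n) x ⊖ (x ⊛ F n x ⊕ (x ⊛ x ^ n) ⊛ e n)
        ≈⟨ solve 4 (λ x t u e →
             (t :+ u :* e) :- (x :* t :+ (x :* u) :* e) := (con 1ℤ :- x) :* (t :+ u :* e)) ≈-refl
             x (F n x) (x ^ n) (e n) ⟩
      (1ₛ ⊖ x) ⊛ F (suc n) x ∎

    -- Iterates the functional equation, collecting the factors of `E k`. The start is `y ^ 1` and
    -- not `y ^ 0`, because each argument must have constant term 0.
    F-product : ∀ {n} k → M ≤ suc n → F (suc n) (y ^ suc k) ≈ E k ⊛ F (suc n) (y ^ 1)
    F-product     zero    M≤1+n = ≈-sym (⊛-identityˡ-≈ _)
    F-product {n} (suc k) M≤1+n = begin
      F (suc n) (y ⊛ y ^ suc k)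
        ≈⟨ F-functional {x = y ^ suc k} (order-^ {y} (suc k) y₀≡0 0 (s≤s z≤n)) M≤1+n ⟩
      (1ₛ ⊖ y ^ suc k) ⊛ F (suc n) (y ^ suc k)
        ≈⟨ ⊛-congˡ (1ₛ ⊖ y ^ suc k) (F-product k M≤1+n) ⟩
      (1ₛ ⊖ y ^ suc k) ⊛ (E k ⊛ F (suc n) (y ^ 1))
        ≈⟨ solve 3 (λ a b c → a :* (b :* c) := (b :* a) :* c) ≈-refl _ (E k) _ ⟩
      E (suc k) ⊛ F (suc n) (y ^ 1) ∎

    F-trivial : ∀ {x} n → x ≈ 0ₛ → F (suc n) x ≈ 1ₛ
    F-trivial     zero    x≈0 = ≈-trans (⊕-identityˡ _) (inverseʳ {1ₛ} refl)
    F-trivial {x} (suc n) x≈0 = begin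
      F (suc n) x ⊕ (x ⊛ x ^ n) ⊛ e (suc n)
        ≈⟨ ⊕-cong (F-trivial n x≈0) (⊛-congʳ (e (suc n)) (⊛-congʳ (x ^ n) x≈0)) ⟩
      1ₛ ⊕ (0ₛ ⊛ x ^ n) ⊛ e (suc n)
        ≈⟨ solve 2 (λ a b → con 1ℤ :+ (con 0ℤ :* a) :* b := con 1ℤ) ≈-refl (x ^ n) (e (suc n)) ⟩
      1ₛ ∎

    -- Here `E M` plays the role of (y;y)_∞. Taking `k = M` in `F-product` gives
    -- `E M ⊛ F (suc n) (y ^ 1)` as the value of `F` at `y ^ suc M`; that argument is zero modulo
    -- `q ^ M`, and F(0) = 1.
    E-F : ∀ {n} k → M ≤ suc n → E M ⊛ F (suc n) (y ^ suc k) ≈ E k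
    E-F {n} k M≤1+n = begin
      E M ⊛ F (suc n) (y ^ suc k)
        ≈⟨ ⊛-congˡ (E M) (F-product k M≤1+n) ⟩
      E M ⊛ (E k ⊛ F (suc n) (y ^ 1))
        ≈⟨ solve 3 (λ a b c → a :* (b :* c) := b :* (a :* c)) ≈-refl (E M) (E k) _ ⟩
      E k ⊛ (E M ⊛ F (suc n) (y ^ 1))
        ≈⟨ ⊛-congˡ (E k) (F-product M M≤1+n) ⟨
      E k ⊛ F (suc n) (y ^ suc M)
        ≈⟨ ⊛-congˡ (E k) (F-trivial n
             (order⇒≈0 (ℕ.n≤1+n M) (order-^ {y} (suc M) y₀≡0))) ⟩
      E k ⊛ 1ₛ
        ≈⟨ ⊛-identityʳ-≈ (E k) ⟩
      E k ∎

-- Identities between q-series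

-- The exponents 2 * k + 1 of the theorem come from summing qⁿ (yⁿ)ᵏ, y = q², over n.
module _ (M : ℕ) where

  open Truncated M
  open Euler (q ^ 2) refl
  open import Relation.Binary.Reasoning.Setoid setoid

  odd : ℕ → Series
  odd k = q ^ (2 * k + 1)

  odd-0 : ∀ k → odd k 0 ≡ 0ℤ
  odd-0 k = order-q^ (2 * k + 1) 0 (ℕ.m≤n+m 1 (2 * k))

  odd-^ : ∀ k n → odd k ^ n ≈ q ^ n ⊛ ((q ^ 2) ^ n) ^ k
  odd-^ k n = begin
    odd k ^ n                  ≈⟨ ^-* q (2 * k + 1) n ⟩
    q ^ (n * (2 * k + 1))      ≡⟨ cong (q ^_) (exponent n k) ⟩
    q ^ (n + k * (n * 2))      ≈⟨ ^-+ q n (k * (n * 2)) ⟩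
    q ^ n ⊛ q ^ (k * (n * 2))  ≈⟨ ⊛-congˡ (q ^ n) (^-* q (n * 2) k) ⟨
    q ^ n ⊛ (q ^ (n * 2)) ^ k  ≈⟨ ⊛-congˡ (q ^ n) (^-cong k (^-* q 2 n)) ⟨
    q ^ n ⊛ ((q ^ 2) ^ n) ^ k  ∎
    where
    exponent : ∀ n k → n * (2 * k + 1) ≡ n + k * (n * 2)
    exponent = Nat.solve 2 (λ n k → n Nat.:* (Nat.con 2 Nat.:* k Nat.:+ Nat.con 1)
      Nat.:= n Nat.:+ k Nat.:* (n Nat.:* Nat.con 2)) refl
      where module Nat = ℕ.+-*-Solver

  -- Proved from right to left: expand each fraction as a geometric series, exchange the sums, and
  -- recognise `F` at (q²)^i in the inner sum. One length `suc n` ≥ `M` serves for both sums and for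
  -- the geometric expansion.
  ∑-lambert : ∀ {n} → M ≤ suc n →
    ∑-partial 1 (λ i → q ^ i ⊛ E (i ∸ 1)) (suc n)
      ≈ E M ⊛ ∑-partial 0 (λ k → odd k ⊛ (1ₛ ⊖ odd k) ⁻¹ ⊛ e k) (suc n)
  ∑-lambert {n} M≤1+n = ≈-sym (begin
    E M ⊛ ∑-partial 0 (λ k → odd k ⊛ (1ₛ ⊖ odd k) ⁻¹ ⊛ e k) K
      ≈⟨ ⊛-congˡ (E M) (∑-cong K λ k → begin
        odd k ⊛ (1ₛ ⊖ odd k) ⁻¹ ⊛ e k
          ≈⟨ ⊛-congʳ (e k) (geometric-inverse {odd k} {K} (odd-0 k)
               (1-q^-constant (2 * k + 1) (ℕ.m≤n+m 1 (2 * k))) M≤1+n) ⟨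
        ∑-partial 1 (odd k ^_) K ⊛ e k
          ≈⟨ ⊛-comm-≈ (∑-partial 1 (odd k ^_) K) (e k) ⟩
        e k ⊛ ∑-partial 1 (odd k ^_) K
          ≈⟨ ⊛-∑ (e k) 1 (odd k ^_) K ⟩
        ∑-partial 1 (λ i → e k ⊛ odd k ^ i) K
          ≈⟨ ∑-cong K (λ i → ≈-trans (⊛-congˡ (e k) (odd-^ k (1 + i)))
               (solve 3 (λ a b c → a :* (b :* c) := b :* (c :* a)) ≈-refl
                 (e k) (q ^ (1 + i)) (((q ^ 2) ^ (1 + i)) ^ k))) ⟩
        ∑-partial 1 (λ i → q ^ i ⊛ (((q ^ 2) ^ i) ^ k ⊛ e k)) K ∎) ⟩
    E M ⊛ ∑-partial 0 (λ k → ∑-partial 1 (λ i → q ^ i ⊛ (((q ^ 2) ^ i) ^ k ⊛ e k)) K) K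
      ≈⟨ ⊛-congˡ (E M) (∑-swap 0 1 (λ k i → q ^ i ⊛ (((q ^ 2) ^ i) ^ k ⊛ e k)) K K) ⟩
    E M ⊛ ∑-partial 1 (λ i → ∑-partial 0 (λ k → q ^ i ⊛ (((q ^ 2) ^ i) ^ k ⊛ e k)) K) K
      ≈⟨ ⊛-∑ (E M) 1 _ K ⟩
    ∑-partial 1 (λ i → E M ⊛ ∑-partial 0 (λ k → q ^ i ⊛ (((q ^ 2) ^ i) ^ k ⊛ e k)) K) K
      -- The index of a sum starting at 1 is `suc i`, so `E (suc i ∸ 1)` computes to `E i`.
      ≈⟨ ∑-cong K (λ i → begin
        E M ⊛ ∑-partial 0 (λ k → q ^ suc i ⊛ (((q ^ 2) ^ suc i) ^ k ⊛ e k)) K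
          ≈⟨ ⊛-congˡ (E M) (⊛-∑ (q ^ suc i) 0 (λ k → ((q ^ 2) ^ suc i) ^ k ⊛ e k) K) ⟨
        E M ⊛ (q ^ suc i ⊛ F K ((q ^ 2) ^ suc i))
          ≈⟨ solve 3 (λ a b c → a :* (b :* c) := b :* (a :* c)) ≈-refl
               (E M) (q ^ suc i) (F K ((q ^ 2) ^ suc i)) ⟩
        q ^ suc i ⊛ (E M ⊛ F K ((q ^ 2) ^ suc i))
          ≈⟨ ⊛-congˡ (q ^ suc i) (E-F i M≤1+n) ⟩
        q ^ suc i ⊛ E i ∎) ⟩
    ∑-partial 1 (λ i → q ^ i ⊛ E (i ∸ 1)) K ∎)
    where K = suc n

  -- Factor by factor, (1 - q^j)(1 + q^j) = 1 - q^(2j).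
  pochhammer-factor : ∀ n → ⟨ q ⨾ q ⟩ n ⊛ ⟨ ⊝ q ⨾ q ⟩ n ≈ E n
  pochhammer-factor zero    = ⊛-identityˡ-≈ 1ₛ
  pochhammer-factor (suc n) = begin
    (P ⊛ (1ₛ ⊖ q ⊛ q ^ n)) ⊛ (D ⊛ (1ₛ ⊖ (⊝ q) ⊛ q ^ n))
      ≈⟨ solve 4 (λ p d a b →
           (p :* (con 1ℤ :- a :* b)) :* (d :* (con 1ℤ :- (:- a) :* b))
             := (p :* d) :* (con 1ℤ :- (a :* b) :* (a :* b))) ≈-refl P D q (q ^ n) ⟩
    (P ⊛ D) ⊛ (1ₛ ⊖ q ^ suc n ⊛ q ^ suc n)
      ≈⟨ ⊛-cong-≈ (pochhammer-factor n) (⊖-congˡ 1ₛ (≈-trans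
           (⊛-congˡ (q ^ suc n) (≈-sym (⊛-identityʳ-≈ (q ^ suc n))))
           (≈-trans (^-* q (suc n) 2) (≈-trans
             (≋⇒≈ λ m → cong (λ j → (q ^ j) m) (ℕ.*-comm 2 (suc n)))
             (≈-sym (^-* q 2 (suc n))))))) ⟩
    E n ⊛ (1ₛ ⊖ (q ^ 2) ^ suc n) ∎
    where
    P = ⟨ q ⨾ q ⟩ n
    D = ⟨ ⊝ q ⨾ q ⟩ n

  module _ (G : ℕ → Series) (G₀ : G 0 ≈ 0ₛ)
    (G-step : ∀ t → G (suc t) ≈ G t ⊕ q ^ suc t ⊛ (G (suc t) ⊕ ⟨ ⊝ q ⨾ q ⟩ t)) where

    -- `G-step` has `G (suc t)` on both sides; the new factor `1ₛ ⊖ q ^ suc t` cancels its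
    -- occurrence on the right. What remains besides the previous stage is `q ^ suc t` times (q;q)_t
    -- (-q;q)_t, which is the next summand.
    pochhammer-recurrence : ∀ t →
      ⟨ q ⨾ q ⟩ t ⊛ G t ≈ ∑-partial 1 (λ i → q ^ i ⊛ E (i ∸ 1)) t
    pochhammer-recurrence zero    = ≈-trans (⊛-congˡ 1ₛ G₀) (⊛-zeroʳ 1ₛ)
    pochhammer-recurrence (suc t) = begin
      (P ⊛ (1ₛ ⊖ x)) ⊛ G (suc t)
        ≈⟨ solve 3 (λ p x g → (p :* (con 1ℤ :- x)) :* g := p :* g :- (p :* x) :* g) ≈-refl
             P x (G (suc t)) ⟩
      P ⊛ G (suc t) ⊖ (P ⊛ x) ⊛ G (suc t)
        ≈⟨ ⊕-congʳ (⊝ ((P ⊛ x) ⊛ G (suc t))) (⊛-congˡ P (G-step t)) ⟩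
      P ⊛ (G t ⊕ x ⊛ (G (suc t) ⊕ D)) ⊖ (P ⊛ x) ⊛ G (suc t)
        ≈⟨ solve 5 (λ p h x g d →
             p :* (h :+ x :* (g :+ d)) :- (p :* x) :* g := p :* h :+ x :* (p :* d)) ≈-refl
             P (G t) x (G (suc t)) D ⟩
      P ⊛ G t ⊕ x ⊛ (P ⊛ D)
        ≈⟨ ⊕-cong (pochhammer-recurrence t) (⊛-congˡ x (pochhammer-factor t)) ⟩
      ∑-partial 1 (λ i → q ^ i ⊛ E (i ∸ 1)) t ⊕ x ⊛ E t ∎
      where
      P = ⟨ q ⨾ q ⟩ t
      D = ⟨ ⊝ q ⨾ q ⟩ t
      x = q ^ suc t

-- Generating functions of overpartitions

-- Without repetitions, equality as sets is equality as multisets, so the lists are permutations of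
-- each other.
length-unique : ∀ {A : Set} {xs ys : List A} → Unique xs → Unique ys →
  (∀ {x} → x ∈ xs → x ∈ ys) → (∀ {x} → x ∈ ys → x ∈ xs) → length xs ≡ length ys
length-unique u v f g = ↭-length (∼bag⇒↭ (unique∧set⇒bag u v (mk⇔ f g)))

Selection : (List Part → Set) → ℕ → List Part → Set
Selection P n π = OverpartitionOf n π × P π

module _ {P : List Part → Set} (P? : Decidable P) where

  selection : ℕ → List (List Part)
  selection n = filter P? (overpartitions n)

  selection-unique : ∀ n → Unique (selection n)
  selection-unique n = Unique.filter⁺ P? (overpartitions-unique n)

  ∈-selection⁻ : ∀ {n π} → π ∈ selection n → Selection P n π
  ∈-selection⁻ {n} {π} π∈ with ∈-filter⁻ P? {xs = overpartitions n} π∈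
  ... | π∈′ , Pπ = Equivalence.to (∈-overpartitions n π) π∈′ , Pπ

  ∈-selection⁺ : ∀ {n π} → Selection P n π → π ∈ selection n
  ∈-selection⁺ {n} {π} (oπ , Pπ) = ∈-filter⁺ P? (Equivalence.from (∈-overpartitions n π) oπ) Pπ

  -- Turns counting into listing: a coefficient is found by exhibiting any repetition-free list of
  -- the overpartitions in question.
  genFun≡length : ∀ {n xs} → Unique xs →
    (∀ {π} → Selection P n π → π ∈ xs) → (∀ {π} → π ∈ xs → Selection P n π) →
    genFun P? n ≡ ℤ.+ length xs
  genFun≡length {n} u f g = cong ℤ.+_
    (length-unique (selection-unique n) u (f ∘ ∈-selection⁻) (∈-selection⁺ ∘ g))

-- The case split has to hold on overpartitions only, as `genFun` sees no other lists.
genFun-⊎ : ∀ {P A B} (P? : Decidable P) (A? : Decidable A) (B? : Decidable B) →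
  (∀ {π} → IsOverpartition π → P π ⇔ (A ∪ B) π) → (∀ {π} → A π → ¬ B π) →
  genFun P? ≋ genFun A? ⊕ genFun B?
genFun-⊎ {P} {A} {B} P? A? B? P⇔A∪B disjoint n = trans
  (genFun≡length P? {n} {as ++ bs}
    (Unique.++⁺ (selection-unique A? n) (selection-unique B? n)
      (λ { (π∈as , π∈bs) →
        disjoint (proj₂ (∈-selection⁻ A? {n} π∈as)) (proj₂ (∈-selection⁻ B? {n} π∈bs)) }))
    (λ { ((isO , w) , Pπ) →
      [ (λ Aπ → ∈-++⁺ˡ (∈-selection⁺ A? ((isO , w) , Aπ)))
      , (λ Bπ → ∈-++⁺ʳ as (∈-selection⁺ B? ((isO , w) , Bπ))) ]′ (Equivalence.to (P⇔A∪B isO) Pπ) })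
    (λ π∈ → [ back inj₁ ∘ ∈-selection⁻ A? , back inj₂ ∘ ∈-selection⁻ B? ]′ (∈-++⁻ as π∈)))
  (cong ℤ.+_ (List.length-++ as))
  where
  as = selection A? n
  bs = selection B? n
  back : ∀ {X : Set} {π} → (X → (A ∪ B) π) → OverpartitionOf n π × X → Selection P n π
  back inj ((isO , w) , x) = (isO , w) , Equivalence.from (P⇔A∪B isO) (inj x)

-- Prepending a part

Cons : Part → (List Part → Set) → List Part → Set
Cons p Q []      = ⊥
Cons p Q (r ∷ ρ) = r ≡ p × Q ρ

_≟ₚ_ : (p r : Part) → Dec (p ≡ r)
part s b ≟ₚ part t c = map′ (λ { (refl , refl) → refl }) (λ { refl → refl , refl })
  ((s ≟ t) ×-dec (b Bool.≟ c))

Cons? : ∀ p {Q} → Decidable Q → Decidable (Cons p Q)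
Cons? p Q? []      = no λ ()
Cons? p Q? (r ∷ ρ) = (r ≟ₚ p) ×-dec Q? ρ

tail-overpartition : ∀ {p ρ} → IsOverpartition (p ∷ ρ) → IsOverpartition ρ
tail-overpartition (isOverpartition (_ ∷ pos) dec (_ ∷ first)) =
  isOverpartition pos (Linked.tail dec) first

-- Deleting the first part `p` is a bijection onto the overpartitions of `n ∸ size p` satisfying
-- `Q`; the hypothesis makes prepending its inverse. If `size p` exceeds `n`, both coefficients are
-- zero.
genFun-cons : ∀ p {Q} (Q? : Decidable Q) →
  (∀ {ρ} → IsOverpartition ρ → Q ρ → IsOverpartition (p ∷ ρ)) →
  genFun (Cons? p Q?) ≋ q ^ size p ⊛ genFun Q?
genFun-cons p Q? cons-overpartition n with size p ≤? n
... | yes p≤n = trans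
  (genFun≡length (Cons? p Q?) {n} {map (p ∷_) (selection Q? (n ∸ size p))}
    (Unique.map⁺ (λ { refl → refl }) (selection-unique Q? (n ∸ size p)))
    (λ { {[]} (_ , ()) ; {_ ∷ ρ} ((isO , w) , refl , Qρ) → ∈-map⁺ (p ∷_)
      (∈-selection⁺ Q? ((tail-overpartition isO ,
        trans (sym (ℕ.m+n∸m≡n (size p) (weight ρ))) (cong (_∸ size p) w)) , Qρ)) })
    (λ π∈ → forward (∈-map⁻ (p ∷_) π∈)))
  (trans (cong ℤ.+_ (List.length-map (p ∷_) (selection Q? (n ∸ size p))))
    (sym (q^⊛-shift (size p) (genFun Q?) n p≤n)))
  where
  forward : ∀ {π} → ∃[ ρ ] (ρ ∈ selection Q? (n ∸ size p) × π ≡ p ∷ ρ) → Selection (Cons p _) n π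
  forward (ρ , ρ∈ , refl) with ∈-selection⁻ Q? {n ∸ size p} ρ∈
  ... | (isO , w) , Qρ =
    (cons-overpartition isO Qρ , trans (cong (size p +_) w) (ℕ.m+[n∸m]≡n p≤n)) , refl , Qρ
... | no p≰n = trans
  (genFun≡length (Cons? p Q?) {n} {[]} []
    (λ { {[]} (_ , ()) ; {_ ∷ ρ} ((_ , w) , refl , _) →
      ⊥-elim (p≰n (subst (size p ≤_) w (ℕ.m≤m+n (size p) (weight ρ)))) })
    (λ ()))
  (sym (order-⊛ˡ (genFun Q?) (order-q^ (size p)) n (ℕ.≰⇒> p≰n)))

head-largest : ∀ {p ρ} → IsOverpartition (p ∷ ρ) → All (λ r → size r ≤ size p) ρ
head-largest isO
  with Linked.Linked⇒AllPairs (λ x y → ℕ.≤-trans y x) (IsOverpartition.nonIncreasing isO)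
... | h ∷ _ = h

-- The restriction on the size of overlined parts keeps an overlined part of size
-- suc t from following another part of that size.
cons-overpartition : ∀ {t b ρ} → IsOverpartition ρ → All (λ r → size r ≤ suc t) ρ →
  All (λ r → Overlined r → size r ≤ t) ρ → IsOverpartition (part (suc t) b ∷ ρ)
cons-overpartition {t} {b} {ρ} (isOverpartition pos dec first) ≤1+t overlined≤t = isOverpartition
  (s≤s z≤n ∷ pos)
  (link dec ≤1+t)
  (All.map (λ o≤t eq o → ℕ.1+n≰n (subst (_≤ t) (sym eq) (o≤t o))) overlined≤t ∷ first)
  where
  link : ∀ {ρ} → Linked (λ p r → size p ≥ size r) ρ → All (λ r → size r ≤ suc t) ρ →
    Linked (λ p r → size p ≥ size r) (part (suc t) b ∷ ρ)
  link []        []      = [-]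
  link [-]       (h ∷ _) = h ∷ [-]
  link (x ∷ dec) (h ∷ _) = h ∷ x ∷ dec

-- Recurrences in the bound on the part sizes

Bounded : ℕ → List Part → Set
Bounded t = All (λ p → size p ≤ t)

bounded? : ∀ t → Decidable (Bounded t)
bounded? t = all? λ p → size p ≤? t

AllOverlined≤ 𝒢ᴺ≤ : ℕ → List Part → Set
AllOverlined≤ t = All Overlined ∩ Bounded t
𝒢ᴺ≤ t           = 𝒢ᴺ ∩ Bounded t

allOverlined≤? : ∀ t → Decidable (AllOverlined≤ t)
allOverlined≤? t = all? (λ p → Bool.T? (overlined p)) ∩? bounded? t

𝒢ᴺ≤? : ∀ t → Decidable (𝒢ᴺ≤ t)
𝒢ᴺ≤? t = 𝒢ᴺ? ∩? bounded? t

bounded-suc : ∀ {t π} → Bounded t π → Bounded (suc t) π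
bounded-suc = All.map ℕ.m≤n⇒m≤1+n

bounded-head : ∀ {t p ρ} → IsOverpartition (p ∷ ρ) → size p ≤ t → Bounded t (p ∷ ρ)
bounded-head isO p≤t = p≤t ∷ All.map (λ r≤p → ℕ.≤-trans r≤p p≤t) (head-largest isO)

bounded-cons-disjoint : ∀ {t b Q π} → Bounded t π → ¬ Cons (part (suc t) b) Q π
bounded-cons-disjoint (1+t≤t ∷ _) (refl , _) = ℕ.1+n≰n 1+t≤t

allOverlined-overpartition : ∀ {t b ρ} → IsOverpartition ρ → AllOverlined≤ t ρ →
  IsOverpartition (part (suc t) b ∷ ρ)
allOverlined-overpartition isO (_ , ρ≤t) =
  cons-overpartition isO (bounded-suc ρ≤t) (All.map (λ r≤t _ → r≤t) ρ≤t)

allOverlined-split : ∀ t {π} → IsOverpartition π → AllOverlined≤ (suc t) π ⇔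
  (AllOverlined≤ t ∪ Cons (part (suc t) true) (AllOverlined≤ t)) π
allOverlined-split t {π} isO = mk⇔ (to isO) (from isO)
  where
  to : ∀ {π} → IsOverpartition π → AllOverlined≤ (suc t) π →
    (AllOverlined≤ t ∪ Cons (part (suc t) true) (AllOverlined≤ t)) π
  to {[]}    _   _ = inj₁ ([] , [])
  to {p ∷ ρ} isO (o ∷ os , p≤1+t ∷ ρ≤1+t) with ℕ.m≤n⇒m<n∨m≡n p≤1+t
  ... | inj₁ (s≤s p≤t) = inj₁ (o ∷ os , bounded-head isO p≤t)
  to {part _ true ∷ ρ} isO (o ∷ os , p≤1+t ∷ ρ≤1+t) | inj₂ refl
    with IsOverpartition.firstOnly isO
  -- A second part of size `suc t` would be overlined without being the first of its size.
  ... | distinct ∷ _ = inj₂ (refl , os , All.tabulate λ r∈ → ℕ.≤-pred (ℕ.≤∧≢⇒<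
    (All.lookup ρ≤1+t r∈) λ eq → All.lookup distinct r∈ (sym eq) (All.lookup os r∈)))

  from : ∀ {π} → IsOverpartition π →
    (AllOverlined≤ t ∪ Cons (part (suc t) true) (AllOverlined≤ t)) π →
    AllOverlined≤ (suc t) π
  from isO (inj₁ (os , π≤t)) = os , bounded-suc π≤t
  from {_ ∷ _} isO (inj₂ (refl , os , ρ≤t)) = tt ∷ os , ℕ.≤-refl ∷ bounded-suc ρ≤t

-- Some non-overlined part has size at most `suc t`, and every overlined part is strictly smaller
-- than it.
overlined-below : ∀ {t ρ} → 𝒢ᴺ≤ (suc t) ρ → All (λ r → Overlined r → size r ≤ t) ρ
overlined-below (𝒢ᴺ-intro _ some above , ρ≤1+t) with find some
... | s , s∈ , s-plain = All.tabulate λ r∈ r-over → ℕ.≤-pred (ℕ.<-≤-trans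
  (All.lookup (All.lookup above s∈) r∈ s-plain r-over) (All.lookup ρ≤1+t s∈))

tail-𝒢ᴺ : ∀ {p ρ} → 𝒢ᴺ (p ∷ ρ) → Any (λ r → ¬ Overlined r) ρ → 𝒢ᴺ ρ
tail-𝒢ᴺ (𝒢ᴺ-intro isO _ (_ ∷ above)) some =
  𝒢ᴺ-intro (tail-overpartition isO) some (All.map All.tail above)

-- The head is a largest part; were it overlined, a non-overlined part further on would have to
-- exceed it.
𝒢ᴺ-head-plain : ∀ {p ρ} → 𝒢ᴺ (p ∷ ρ) → ¬ Overlined p
𝒢ᴺ-head-plain (𝒢ᴺ-intro isO (here plain) _) = plain
𝒢ᴺ-head-plain (𝒢ᴺ-intro isO (there some) (_ ∷ above)) over with find some
... | r , r∈ , r-plain =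
  ℕ.<⇒≱ (All.head (All.lookup above r∈) r-plain over) (All.lookup (head-largest isO) r∈)

-- What can follow a non-overlined part of size `suc t`. If non-overlined parts remain, they may
-- repeat that size; if none remain, the overlined parts must be strictly smaller. Hence the
-- different bounds, and the summands G_{t+1} and D_t of the recurrence.
PlainTail : ℕ → List Part → Set
PlainTail t = 𝒢ᴺ≤ (suc t) ∪ AllOverlined≤ t

plainTail-bounded : ∀ {t ρ} → PlainTail t ρ → Bounded (suc t) ρ
plainTail-bounded (inj₁ (_ , ρ≤)) = ρ≤
plainTail-bounded (inj₂ (_ , ρ≤)) = bounded-suc ρ≤

plainTail-overlined : ∀ {t ρ} → PlainTail t ρ → All (λ r → Overlined r → size r ≤ t) ρ
plainTail-overlined (inj₁ g)        = overlined-below g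
plainTail-overlined (inj₂ (_ , ρ≤)) = All.map (λ r≤t _ → r≤t) ρ≤

plainTail-overpartition : ∀ {t b ρ} → IsOverpartition ρ → PlainTail t ρ →
  IsOverpartition (part (suc t) b ∷ ρ)
plainTail-overpartition isO tl =
  cons-overpartition isO (plainTail-bounded tl) (plainTail-overlined tl)

plainTail-above : ∀ {t ρ} → PlainTail t ρ →
  All (λ p → All (λ r → ¬ Overlined p → Overlined r → size r < size p) ρ) ρ
plainTail-above (inj₁ (g , _)) = 𝒢ᴺ.nonOverlinedAbove g
plainTail-above (inj₂ (os , _)) = All.map (λ o → All.tabulate λ _ plain → ⊥-elim (plain o)) os

𝒢ᴺ-split : ∀ t {π} → IsOverpartition π → 𝒢ᴺ≤ (suc t) π ⇔
  (𝒢ᴺ≤ t ∪ Cons (part (suc t) false) (PlainTail t)) π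
𝒢ᴺ-split t isO = mk⇔ to (from isO)
  where
  to : ∀ {π} → 𝒢ᴺ≤ (suc t) π → (𝒢ᴺ≤ t ∪ Cons (part (suc t) false) (PlainTail t)) π
  to {[]}    (𝒢ᴺ-intro _ () _ , _)
  to {p ∷ ρ} (g , p≤1+t ∷ ρ≤1+t) with ℕ.m≤n⇒m<n∨m≡n p≤1+t
  ... | inj₁ (s≤s p≤t) = inj₁ (g , bounded-head (𝒢ᴺ.overpartition g) p≤t)
  to {part _ true  ∷ ρ} (g , p≤1+t ∷ ρ≤1+t) | inj₂ refl = ⊥-elim (𝒢ᴺ-head-plain g tt)
  to {part _ false ∷ ρ} (g , p≤1+t ∷ ρ≤1+t) | inj₂ refl
    with any? (λ r → ¬? (Bool.T? (overlined r))) ρ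
  ... | yes some = inj₂ (refl , inj₁ (tail-𝒢ᴺ g some , ρ≤1+t))
  -- The tail is entirely overlined, and comparing it with the non-overlined head gives sizes below
  -- `suc t`.
  ... | no  none = inj₂ (refl , inj₂ (os , All.zipWith
      (λ { (below , o) → ℕ.≤-pred (below (λ ()) o) })
      (All.tail (All.head (𝒢ᴺ.nonOverlinedAbove g)) , os)))
    where
    os : All Overlined ρ
    os = All.map (λ {r} → decidable-stable (Bool.T? (overlined r))) (¬Any⇒All¬ ρ none)

  from : ∀ {π} → IsOverpartition π →
    (𝒢ᴺ≤ t ∪ Cons (part (suc t) false) (PlainTail t)) π → 𝒢ᴺ≤ (suc t) π
  from isO (inj₁ (g , π≤t)) = g , bounded-suc π≤t
  from {_ ∷ _} isO (inj₂ (refl , tl)) =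
    𝒢ᴺ-intro isO (here λ ())
      -- Only comparisons of the head with overlined parts of the tail have content: the head itself
      -- is not overlined, so it never occurs as the smaller, overlined part.
      (((λ _ ()) ∷ All.map (λ o≤t _ o → s≤s (o≤t o)) (plainTail-overlined tl))
        ∷ All.map ((λ _ ()) ∷_) (plainTail-above tl))
    , ℕ.≤-refl ∷ plainTail-bounded tl

nothing-bounded-by-0 : ∀ {p ρ} → IsOverpartition (p ∷ ρ) → ¬ Bounded 0 (p ∷ ρ)
nothing-bounded-by-0 isO (p≤0 ∷ _) = ℕ.<⇒≱ (All.head (IsOverpartition.positive isO)) p≤0

genFun-allOverlined-0 : genFun (allOverlined≤? 0) ≋ 1ₛ
genFun-allOverlined-0 zero    = refl
genFun-allOverlined-0 (suc n) = genFun≡length (allOverlined≤? 0) {suc n} {[]} []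
  (λ { {[]} ((_ , ()) , _)
     ; {_ ∷ _} ((isO , _) , _ , ρ≤0) → ⊥-elim (nothing-bounded-by-0 isO ρ≤0) }) (λ ())

genFun-allOverlined-suc : ∀ t → genFun (allOverlined≤? (suc t)) ≋
  genFun (allOverlined≤? t) ⊕ q ^ suc t ⊛ genFun (allOverlined≤? t)
genFun-allOverlined-suc t m = trans
  (genFun-⊎ (allOverlined≤? (suc t)) (allOverlined≤? t) (Cons? _ (allOverlined≤? t))
    (allOverlined-split t) (bounded-cons-disjoint ∘ proj₂) m)
  (cong (ℤ._+_ (genFun (allOverlined≤? t) m))
    (genFun-cons (part (suc t) true) (allOverlined≤? t) allOverlined-overpartition m))

genFun-𝒢ᴺ-0 : genFun (𝒢ᴺ≤? 0) ≋ 0ₛ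
genFun-𝒢ᴺ-0 n = genFun≡length (𝒢ᴺ≤? 0) {n} {[]} []
  (λ { {[]} (_ , 𝒢ᴺ-intro _ () _ , _)
     ; {_ ∷ _} ((isO , _) , _ , ρ≤0) → ⊥-elim (nothing-bounded-by-0 isO ρ≤0) }) (λ ())

genFun-𝒢ᴺ-suc : ∀ t → genFun (𝒢ᴺ≤? (suc t)) ≋
  genFun (𝒢ᴺ≤? t) ⊕ q ^ suc t ⊛ (genFun (𝒢ᴺ≤? (suc t)) ⊕ genFun (allOverlined≤? t))
genFun-𝒢ᴺ-suc t m = trans
  (genFun-⊎ (𝒢ᴺ≤? (suc t)) (𝒢ᴺ≤? t) (Cons? _ tail?) (𝒢ᴺ-split t) (bounded-cons-disjoint ∘ proj₂) m)
  (cong (ℤ._+_ (genFun (𝒢ᴺ≤? t) m)) (trans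
    (genFun-cons (part (suc t) false) tail? plainTail-overpartition m)
    (⊛-congʳ-below (q ^ suc t) m λ j _ →
      genFun-⊎ tail? (𝒢ᴺ≤? (suc t)) (allOverlined≤? t) (λ _ → mk⇔ id id)
        (λ { (g , _) (os , _) → let _ , r∈ , plain = find (𝒢ᴺ.someNonOverlined g) in
          plain (All.lookup os r∈) }) j)))
  where
  tail? : Decidable (PlainTail t)
  tail? = 𝒢ᴺ≤? (suc t) ∪? allOverlined≤? t

-- No part exceeds the weight `m`, so the bound `t` excludes nothing.
genFun-𝒢ᴺ≤ : ∀ m t → m < t → genFun 𝒢ᴺ? m ≡ genFun (𝒢ᴺ≤? t) m
genFun-𝒢ᴺ≤ m t m<t = genFun≡length 𝒢ᴺ? {m} (selection-unique (𝒢ᴺ≤? t) m)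
  (λ { {π} ((isO , refl) , g) → ∈-selection⁺ (𝒢ᴺ≤? t) ((isO , refl) , g ,
    All.map (λ s≤w → ℕ.≤-trans s≤w (ℕ.<⇒≤ m<t)) (sizes≤weight π)) })
  (λ π∈ → let oπ , g , _ = ∈-selection⁻ (𝒢ᴺ≤? t) {m} π∈ in oπ , g)

genFun-allOverlined : ∀ t → genFun (allOverlined≤? t) ≋ ⟨ ⊝ q ⨾ q ⟩ t
genFun-allOverlined zero    = genFun-allOverlined-0
-- Coefficient `m` is read off modulo `q ^ suc m`, where the ring solver is available.
genFun-allOverlined (suc t) = λ m → below (step (suc m)) m (ℕ.n<1+n m)
  where
  open Truncated using (below)
  step : ∀ M → let open Truncated M in genFun (allOverlined≤? (suc t)) ≈ ⟨ ⊝ q ⨾ q ⟩ suc t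
  step M = begin
    genFun (allOverlined≤? (suc t))
      ≈⟨ ≋⇒≈ (genFun-allOverlined-suc t) ⟩
    genFun (allOverlined≤? t) ⊕ q ^ suc t ⊛ genFun (allOverlined≤? t)
      ≈⟨ solve 3 (λ d a b → d :+ (a :* b) :* d := d :* (con 1ℤ :- (:- a) :* b)) ≈-refl
           (genFun (allOverlined≤? t)) q (q ^ t) ⟩
    genFun (allOverlined≤? t) ⊛ (1ₛ ⊖ (⊝ q) ⊛ q ^ t)
      ≈⟨ ⊛-congʳ (1ₛ ⊖ (⊝ q) ⊛ q ^ t) (≋⇒≈ (genFun-allOverlined t)) ⟩
    ⟨ ⊝ q ⨾ q ⟩ suc t ∎
    where
    open Truncated M
    open import Relation.Binary.Reasoning.Setoid setoid

genFun-𝒢ᴺ-step : ∀ t → genFun (𝒢ᴺ≤? (suc t)) ≋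
  genFun (𝒢ᴺ≤? t) ⊕ q ^ suc t ⊛ (genFun (𝒢ᴺ≤? (suc t)) ⊕ ⟨ ⊝ q ⨾ q ⟩ t)
genFun-𝒢ᴺ-step t m = trans (genFun-𝒢ᴺ-suc t m)
  (cong (ℤ._+_ (genFun (𝒢ᴺ≤? t) m)) (⊛-congʳ-below (q ^ suc t) m λ j _ →
    cong (ℤ._+_ (genFun (𝒢ᴺ≤? (suc t)) j)) (genFun-allOverlined t j)))

-- From the truncated identities to the infinite ones

mainTheorem9 : (genFun 𝒢ᴺ? ≋
    ⟨ q ⨾q⟩∞ ⁻¹ ⊛ ∑≥ 1 (λ n → q ^ n ⊛ ⟨ q ^ 2 ⨾ q ^ 2 ⟩ (n ∸ 1)) summable₁)
    ×
    (⟨ q ⨾q⟩∞ ⁻¹ ⊛ ∑≥ 1 (λ n → q ^ n ⊛ ⟨ q ^ 2 ⨾ q ^ 2 ⟩ (n ∸ 1)) summable₁ ≋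
    ⟨ ⊝ q ⨾q⟩∞ ⊛ ∑≥ 0 (λ n → q ^ (2 * n + 1) ⊛ (1ₛ ⊖ q ^ (2 * n + 1)) ⁻¹ ⊛ (⟨ q ^ 2 ⨾ q ^ 2 ⟩ n) ⁻¹) summable₂)
mainTheorem9 =
  (λ m → below (first (suc m)) m (ℕ.n<1+n m)) , (λ m → below (second m) m (ℕ.n<1+n m))
  where
  open Truncated using (below)

  s l : ℕ → Series
  s n = q ^ n ⊛ ⟨ q ^ 2 ⨾ q ^ 2 ⟩ (n ∸ 1)
  l n = q ^ (2 * n + 1) ⊛ (1ₛ ⊖ q ^ (2 * n + 1)) ⁻¹ ⊛ (⟨ q ^ 2 ⨾ q ^ 2 ⟩ n) ⁻¹

  S∞ L∞ : Series
  S∞ = ∑≥ 1 s summable₁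
  L∞ = ∑≥ 0 l summable₂

  module _ (M : ℕ) where
    open Truncated M
    open import Relation.Binary.Reasoning.Setoid setoid
    private
      P = ⟨ q ⨾ q ⟩ M
      S = ∑-partial 1 s M

    P₀≡1 : P 0 ≡ 1ℤ
    P₀≡1 = ⟨⨾⟩-constant q q M refl

    truncate : ⟨ q ⨾q⟩∞ ⁻¹ ⊛ S∞ ≈ P ⁻¹ ⊛ S
    truncate = ⊛-cong-≈ (⁻¹-cong (⟨⨾q⟩∞-constant q refl) P₀≡1 (lim≈ (⟨⨾q⟩-convergent q) λ _ → refl))
      (lim≈ summable₁ λ _ → refl)

    first : genFun 𝒢ᴺ? ≈ ⟨ q ⨾q⟩∞ ⁻¹ ⊛ S∞
    first = begin
      genFun 𝒢ᴺ?         ≈⟨ agree (λ m m<M → genFun-𝒢ᴺ≤ m M m<M) ⟩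
      genFun (𝒢ᴺ≤? M)    ≈⟨ inverse-unique {P}
                              (pochhammer-recurrence M (genFun ∘ 𝒢ᴺ≤?)
                                (≋⇒≈ genFun-𝒢ᴺ-0) (λ t → ≋⇒≈ (genFun-𝒢ᴺ-step t)) M) P₀≡1 ⟩
      S ⊛ P ⁻¹           ≈⟨ ⊛-comm-≈ S (P ⁻¹) ⟩
      P ⁻¹ ⊛ S           ≈⟨ truncate ⟨
      ⟨ q ⨾q⟩∞ ⁻¹ ⊛ S∞ ∎

  -- The modulus is written as a successor because `∑-lambert` concerns sums of positive length.
  module _ (m : ℕ) where
    open Truncated (suc m)
    open import Relation.Binary.Reasoning.Setoid setoid
    private
      M = suc m
      P = ⟨ q ⨾ q ⟩ M
      D = ⟨ ⊝ q ⨾ q ⟩ M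
      E = ⟨ q ^ 2 ⨾ q ^ 2 ⟩ M
      S = ∑-partial 1 s M
      L = ∑-partial 0 l M

    second : ⟨ q ⨾q⟩∞ ⁻¹ ⊛ S∞ ≈ ⟨ ⊝ q ⨾q⟩∞ ⊛ L∞
    second = begin
      _                     ≈⟨ truncate M ⟩
      P ⁻¹ ⊛ S              ≈⟨ ⊛-congˡ (P ⁻¹) (∑-lambert M ℕ.≤-refl) ⟩
      -- Splitting (q²;q²)_M as (q;q)_M (-q;q)_M cancels the denominator and leaves the product
      -- (-q;q)_M.
      P ⁻¹ ⊛ (E ⊛ L)        ≈⟨ ⊛-congˡ (P ⁻¹) (⊛-congʳ L (pochhammer-factor M M)) ⟨
      P ⁻¹ ⊛ ((P ⊛ D) ⊛ L)  ≈⟨ solve 4 (λ i p d l → i :* ((p :* d) :* l) := (p :* i) :* (d :* l))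
                                 ≈-refl (P ⁻¹) P D L ⟩
      (P ⊛ P ⁻¹) ⊛ (D ⊛ L)  ≈⟨ ⊛-congʳ (D ⊛ L) (inverseʳ {P} (P₀≡1 M)) ⟩
      1ₛ ⊛ (D ⊛ L)          ≈⟨ ⊛-identityˡ-≈ (D ⊛ L) ⟩
      D ⊛ L                 ≈⟨ ⊛-cong-≈ (lim≈ (⟨⨾q⟩-convergent (⊝ q)) λ _ → refl)
                                           (lim≈ summable₂ λ _ → refl) ⟨
      _                     ∎
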